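{- Let $(X,<)$ be a linearly ordered set. For all ultrafilters $u,v\in\beta X$: $$u\,\tilde<\,v \iff \mathrm{supp}(u)<\mathrm{supp}(v)\ \vee\ \mathrm{supp}(u)=\mathrm{supp}(v)=I_u=I_v,$$ $$u\,\tilde\le\,v \iff \mathrm{supp}(u)<\mathrm{supp}(v)\ \vee\ \mathrm{supp}(u)=\mathrm{supp}(v)=I_u=I_v\ \vee\ \exists x\in X\,(u=v=\tilde x),$$ $$u\,\tilde>\,v \iff \mathrm{supp}(u)>\mathrm{supp}(v)\ \vee\ \mathrm{supp}(u)=\mathrm{supp}(v)=J_u=J_v,$$ $$u\,\tilde\ge\,v \iff \mathrm{supp}(u)>\mathrm{supp}(v)\ \vee\ \mathrm{supp}(u)=\mathrm{supp}(v)=J_u=J_v\ \vee\ \exists x\in X\,(u=v=\tilde x).$$ Consequently, on non-principal ultrafilters, $\tilde<$ coincides with $\tilde\le$ and $\tilde>$ coincides with $\tilde\ge$.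
   Context: $(X,<)$ is a linear order, $\le$ its reflexive version, $>$ and $\ge$ the converse relations. $\beta X$ is the set of all ultrafilters over $X$; $\tilde x=\{S\subseteq X:x\in S\}$ for $x\in X$. For a binary relation $R$ on $X$, its ultrafilter extension $\tilde R$ on $\beta X$ is defined by $u\,\tilde R\,v\iff\{x\in X:\{y\in X:x\,R\,y\}\in v\}\in u$. Initial segments are downward closed subsets, final segments upward closed subsets. $I_u=\bigcap\{I\in u: I\text{ initial segment}\}$, $J_u=\bigcap\{J\in u: J\text{ final segment}\}$. For non-principal $u$ exactly one of $I_u\in u$, $J_u\in u$ holds. Supports: if $u=\tilde x$ then $\mathrm{supp}(u)=\{x\}$ (a "point"); if $u$ is non-principal and $I_u\in u$ then $\mathrm{supp}(u)$ is $I_u$ regarded as a left half-cut (a nonempty initial segment with no greatest element); if $u$ is non-principal and $J_u\in u$ then $\mathrm{supp}(u)$ is $J_u$ regarded as a right half-cut (a nonempty final segment with no least element). Two supports are equal iff they are of the same kind (point/left/right) and equal as sets. The notation "$\mathrm{supp}(u)=I_u$" means "$u$ is non-principal and $I_u\in u$", and "$\mathrm{supp}(u)=J_u$" means "$u$ is non-principal and $J_u\in u$"; thus $\mathrm{supp}(u)=\mathrm{supp}(v)=I_u=I_v$ means both are non-principal, $I_u\in u$, $I_v\in v$ and $I_u=I_v$ (similarly for $J$). The natural linear order on supports (points $\{x\}$, left half-cuts $I$, right half-cuts $J$): $\{x\}<\{y\}$ iff $x<y$; $\{x\}<I$ iff $x\in I$, and $I<\{x\}$ iff $x\notin I$; $\{x\}<J$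 iff $x\notin J$, and $J<\{x\}$ iff $x\in J$; $I<I'$ iff $I\subsetneq I'$; $J<J'$ iff $J\supsetneq J'$; $I<J$ iff $I\cap J=\emptyset$, and $J<I$ iff $I\cap J\neq\emptyset$. Write $\le$ for its reflexive version. -}

module Defs where

open import Axiom.ExcludedMiddle using (ExcludedMiddle)
open import Data.Empty using (⊥-elim)
import Data.Empty.Polymorphic as Empty
import Data.Unit.Polymorphic as Unit
open import Data.Product using (Σ; ∃; _×_; _,_; proj₁; proj₂)
open import Data.Sum using (_⊎_; inj₁; inj₂)
open import Function using (flip)
open import Level using (Level; Lift; lift; lower; suc)
open import Relation.Binary using (Rel; IsStrictTotalOrder; tri<; tri≈; tri>)
import Relation.Binary.Construct.Flip.EqAndOrd as Flip
import Relation.Binary.Construct.StrictToNonStrict as ToNonStrict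
open import Relation.Binary.PropositionalEquality using (_≡_; refl; sym; subst)
open import Relation.Nullary using (¬_; Dec; yes; no)
open import Relation.Nullary.Decidable using (True; toWitness; fromWitness; map′)
open import Relation.Unary
  using (Pred; _∈_; _∉_; _⊆_; _⊂_; _⊃_; _≐_; _∩_; ∁; ⋂; _≬_; _⊥_; Satisfiable)

private variable
  ℓ : Level

-- Subsets of X : Set ℓ are predicates of level ℓ, and so is an ultrafilter,
-- as a predicate on subsets: then { x ∣ S x ∈ v } is again a subset.
-- Excluded middle (the ambient logic is classical) makes up for the missing
-- impredicativity: it resizes any proposition of the next level.

module Classical (em : ExcludedMiddle (suc ℓ)) where

  em₀ : ExcludedMiddle ℓ
  em₀ {P} = map′ lower lift (em {Lift (suc ℓ) P})

  Resize : Set (suc ℓ) → Set ℓ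
  Resize P = Lift ℓ (True (em {P}))

  resize : ∀ {P} → P → Resize P
  resize p = lift (fromWitness p)

  unresize : ∀ {P} → Resize P → P
  unresize (lift t) = toWitness t

record Ultrafilter (X : Set ℓ) : Set (suc ℓ) where
  field
    members      : Pred (Pred X ℓ) ℓ
    full∈        : (λ _ → Unit.⊤) ∈ members
    empty∉       : (λ _ → Empty.⊥) ∉ members
    upwardClosed : ∀ {S T} → S ⊆ T → S ∈ members → T ∈ members
    ∩-closed     : ∀ {S T} → S ∈ members → T ∈ members → (S ∩ T) ∈ members
    ultra        : ∀ S → S ∈ members ⊎ ∁ S ∈ members

open Ultrafilter

module _ {X : Set ℓ} where

  infix 4 _∈ᵤ_ _≈ᵤ_

  _∈ᵤ_ : Pred X ℓ → Ultrafilter X → Set ℓ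
  S ∈ᵤ u = S ∈ members u

  _≈ᵤ_ : Rel (Ultrafilter X) (suc ℓ)
  u ≈ᵤ v = members u ≐ members v

  Extension : Rel X ℓ → Rel (Ultrafilter X) ℓ
  Extension R u v = (λ x → (λ y → R x y) ∈ᵤ v) ∈ᵤ u

  member-satisfiable : ∀ (u : Ultrafilter X) {S} → S ∈ᵤ u → ¬ ¬ Satisfiable S
  member-satisfiable u S∈u ¬sat =
    empty∉ u (upwardClosed u (λ x∈S → ⊥-elim (¬sat (_ , x∈S))) S∈u)

module Principality (em : ExcludedMiddle (suc ℓ)) (X : Set ℓ) where
  open Classical em

  principal : X → Ultrafilter X
  principal x = record
    { members      = λ S → x ∈ S
    ; full∈        = _
    ; empty∉       = λ ()
    ; upwardClosed = λ S⊆T → S⊆T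
    ; ∩-closed     = _,_
    ; ultra        = λ S → decide (em₀ {S x})
    }
    where
    decide : ∀ {P : Set ℓ} → Dec P → P ⊎ ¬ P
    decide (yes p) = inj₁ p
    decide (no ¬p) = inj₂ ¬p

  Principal NonPrincipal : Pred (Ultrafilter X) (suc ℓ)
  Principal u    = ∃ λ x → u ≈ᵤ principal x
  NonPrincipal u = ¬ Principal u

  singleton-principal : ∀ u {x} → (λ y → y ≡ x) ∈ᵤ u → u ≈ᵤ principal x
  singleton-principal u {x} x∈u = to , from
    where
    from : ∀ {S} → x ∈ S → S ∈ᵤ u
    from {S} x∈S = upwardClosed u (λ { refl → x∈S }) x∈u
    to : ∀ {S} → S ∈ᵤ u → x ∈ S
    to {S} S∈u with em₀ {x ∈ S}
    ... | yes x∈S = x∈S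
    ... | no  x∉S = ⊥-elim (member-satisfiable u (∩-closed u S∈u x∈u)
                      λ { (_ , y∈S , refl) → x∉S y∈S })

module Segments (em : ExcludedMiddle (suc ℓ)) {X : Set ℓ} {_<_ : Rel X ℓ}
                (isSTO : IsStrictTotalOrder _≡_ _<_) where
  open Classical em
  open Principality em X
  open IsStrictTotalOrder isSTO using (compare; trans; irrefl)
  open ToNonStrict _≡_ _<_ using (_≤_) public

  Initial Final : Pred (Pred X ℓ) ℓ
  Initial S = ∀ {x y} → x < y → y ∈ S → x ∈ S
  Final   S = ∀ {x y} → y < x → y ∈ S → x ∈ S

  Greatest Least : Pred X ℓ → Pred X ℓ
  Greatest S m = m ∈ S × (∀ {x} → x ∈ S → x ≤ m)
  Least    S m = m ∈ S × (∀ {x} → x ∈ S → m ≤ x)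

  I J : Ultrafilter X → Pred X ℓ
  I u x = Resize (x ∈ ⋂ (∃ λ S → S ∈ᵤ u × Initial S) proj₁)
  J u x = Resize (x ∈ ⋂ (∃ λ S → S ∈ᵤ u × Final S) proj₁)

  record IsLeftHalfCut (S : Pred X ℓ) : Set ℓ where
    field
      nonempty   : Satisfiable S
      initial    : Initial S
      noGreatest : ¬ Satisfiable (Greatest S)

  record IsRightHalfCut (S : Pred X ℓ) : Set ℓ where
    field
      nonempty : Satisfiable S
      final    : Final S
      noLeast  : ¬ Satisfiable (Least S)

  I-isLeftHalfCut : ∀ u → NonPrincipal u → I u ∈ᵤ u → IsLeftHalfCut (I u)
  I-isLeftHalfCut u np I∈u = record
    { nonempty   = nonempty
    ; initial    = λ x<y y∈I → resize λ { (S , S∈u , ini) →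
                     ini x<y (unresize y∈I (S , S∈u , ini)) }
    ; noGreatest = noGreatest
    }
    where
    nonempty : Satisfiable (I u)
    nonempty with em₀ {Satisfiable (I u)}
    ... | yes sat = sat
    ... | no ¬sat = ⊥-elim (member-satisfiable u I∈u ¬sat)

    noGreatest : ¬ Satisfiable (Greatest (I u))
    noGreatest (m , m∈I , max) with ultra u (_< m)
    ... | inj₁ below = irrefl refl (unresize m∈I (_ , below , trans))
    ... | inj₂ above = np (m , singleton-principal u
            (upwardClosed u (λ { (x≮m , x∈I) → only x≮m (max x∈I) })
              (∩-closed u above I∈u)))
      where
      only : ∀ {x} → ¬ x < m → x ≤ m → x ≡ m
      only x≮m (inj₁ x<m) = ⊥-elim (x≮m x<m)
      only x≮m (inj₂ x≡m) = x≡m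

  J∈u : ∀ u → ¬ (I u ∈ᵤ u) → J u ∈ᵤ u
  J∈u u I∉u with ultra u (I u)
  ... | inj₁ I∈u = ⊥-elim (I∉u I∈u)
  ... | inj₂ C∈u = upwardClosed u
          (λ x∉I → resize λ { (F , F∈u , fin) → inF x∉I F∈u fin }) C∈u
    where
    inF : ∀ {x F} → x ∉ I u → F ∈ᵤ u → Final F → x ∈ F
    inF {x} {F} x∉I F∈u fin with em₀ {x ∈ F}
    ... | yes x∈F = x∈F
    ... | no  x∉F = ⊥-elim (x∉I (resize λ { (S , S∈u , ini) → inS S∈u ini }))
      where
      inS : ∀ {S} → S ∈ᵤ u → Initial S → x ∈ S
      inS {S} S∈u ini with em₀ {x ∈ S}
      ... | yes x∈S = x∈S
      ... | no  x∉S = ⊥-elim (member-satisfiable u (∩-closed u S∈u F∈u)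
                        λ { (y , y∈S , y∈F) → between y y∈S y∈F })
        where
        between : ∀ y → y ∈ S → ¬ (y ∈ F)
        between y y∈S y∈F with compare x y
        ... | tri< x<y _ _  = x∉S (ini x<y y∈S)
        ... | tri≈ _ refl _ = x∉S y∈S
        ... | tri> _ _ y<x  = x∉F (fin y<x y∈F)

module Supports (em : ExcludedMiddle (suc ℓ)) {X : Set ℓ} {_<_ : Rel X ℓ}
                (isSTO : IsStrictTotalOrder _≡_ _<_) where
  open Principality em X public
  open Segments em isSTO public

  private
    module Dual = Segments em (Flip.isStrictTotalOrder isSTO)

  J-isRightHalfCut : ∀ u → NonPrincipal u → J u ∈ᵤ u → IsRightHalfCut (J u)
  J-isRightHalfCut u np J∈ = record
    { nonempty = nonempty
    ; final    = initial
    ; noLeast  = λ { (m , m∈J , min) →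
                   noGreatest (m , m∈J , λ x∈J → ≤-flip (min x∈J)) }
    }
    where
    open Dual.IsLeftHalfCut (Dual.I-isLeftHalfCut u np J∈)
    ≤-flip : ∀ {x y} → x ≤ y → y Dual.≤ x
    ≤-flip (inj₁ x<y) = inj₁ x<y
    ≤-flip (inj₂ x≡y) = inj₂ (sym x≡y)

  data Support : Set (suc ℓ) where
    point : X → Support
    left  : (S : Pred X ℓ) → IsLeftHalfCut S → Support
    right : (S : Pred X ℓ) → IsRightHalfCut S → Support

  infix 4 _<ₛ_ _>ₛ_

  _<ₛ_ _>ₛ_ : Rel Support ℓ
  point x   <ₛ point y   = x < y
  point x   <ₛ left S _  = x ∈ S
  point x   <ₛ right S _ = x ∉ S
  left S _  <ₛ point x   = x ∉ S
  left S _  <ₛ left T _  = S ⊂ T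
  left S _  <ₛ right T _ = S ⊥ T
  right S _ <ₛ point x   = x ∈ S
  right S _ <ₛ left T _  = T ≬ S
  right S _ <ₛ right T _ = S ⊃ T

  _>ₛ_ = flip _<ₛ_

  -- If u is generated by a point, that point is unique, so the choice of
  -- witness made by em is immaterial.
  supp : Ultrafilter X → Support
  supp u = cases em (Classical.em₀ em)
    where
    cases : Dec (Principal u) → Dec (I u ∈ᵤ u) → Support
    cases (yes (x , _)) _         = point x
    cases (no np)       (yes I∈u) = left (I u) (I-isLeftHalfCut u np I∈u)
    cases (no np)       (no I∉u)  = right (J u) (J-isRightHalfCut u np (J∈u u I∉u))

  SuppIsI SuppIsJ : Pred (Ultrafilter X) (suc ℓ)
  SuppIsI u = NonPrincipal u × I u ∈ᵤ u
  SuppIsJ u = NonPrincipal u × J u ∈ᵤ u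

  SameI SameJ : Rel (Ultrafilter X) (suc ℓ)
  SameI u v = SuppIsI u × SuppIsI v × I u ≐ I v
  SameJ u v = SuppIsJ u × SuppIsJ v × J u ≐ J v

  SamePoint : Rel (Ultrafilter X) (suc ℓ)
  SamePoint u v = ∃ λ x → u ≈ᵤ principal x × v ≈ᵤ principal x

  infix 4 _<~_ _≤~_ _>~_ _≥~_

  _<~_ _≤~_ _>~_ _≥~_ : Rel (Ultrafilter X) ℓ
  _<~_ = Extension _<_
  _≤~_ = Extension _≤_
  _>~_ = Extension (flip _<_)
  _≥~_ = Extension (flip _≤_)

{-# OPTIONS --safe #-}

-- For every ultrafilter v the set { x ∣ (x , ∞) ∈ v } is the initial segment
-- of the points below supp v, so u <~ v says that this segment belongs to u.
-- An initial segment T belongs to u iff it contains the point, contains the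
-- left half-cut, or meets the right half-cut that is the support of u.
-- Comparing the two descriptions kind by kind gives the claim for <~; that for
-- >~ is the same claim for the reversed order; and the extension of a reflexive
-- closure only adds the pairs of equal principal ultrafilters.

module Submission where

open import Defs
open import Axiom.ExcludedMiddle using (ExcludedMiddle)
open import Data.Empty using (⊥-elim)
import Data.Empty.Polymorphic as Empty
open import Data.Product using (∃; _×_; _,_; proj₁; proj₂)
open import Data.Sum using (_⊎_; inj₁; inj₂; [_,_]; map₁; map₂; assocʳ; assocˡ)
open import Function using (flip; id; _∘_)
open import Function.Bundles using (_⇔_; mk⇔; module Equivalence)
open import Level using (Level; suc)
open import Relation.Binary using (Rel; IsStrictTotalOrder; tri<; tri≈; tri>)
import Relation.Binary.Construct.Flip.EqAndOrd as Flip
open import Relation.Binary.PropositionalEquality using (_≡_; refl; sym)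
open import Relation.Nullary using (¬_; yes; no)
open import Relation.Nullary.Decidable using (decidable-stable)
open import Relation.Unary using (Pred; _∈_; _∉_; _⊆_; _≐_; ∁; _≬_; Satisfiable)
open import Relation.Unary.Properties using (≬-sym; ⊥-sym)

open Equivalence using (to; from)
open Ultrafilter

-- Ultrafilters and the extension of a reflexive closure.

module UltrafilterProperties {ℓ : Level} (em : ExcludedMiddle (suc ℓ)) {X : Set ℓ} where
  open Classical em
  open Principality em X

  stable : ∀ {P : Set ℓ} → ¬ ¬ P → P
  stable = decidable-stable em₀

  satisfiable : ∀ (u : Ultrafilter X) {S} → S ∈ᵤ u → Satisfiable S
  satisfiable u S∈u = stable (member-satisfiable u S∈u)

  ∁-member : ∀ (u : Ultrafilter X) {S} → ¬ S ∈ᵤ u → ∁ S ∈ᵤ u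
  ∁-member u {S} S∉u = [ ⊥-elim ∘ S∉u , id ] (ultra u S)

  EqualPrincipal : Rel (Ultrafilter X) (suc ℓ)
  EqualPrincipal u v = ∃ λ x → u ≈ᵤ principal x × v ≈ᵤ principal x

  module _ {R R′ : Rel X ℓ} (closure : ∀ {x y} → R′ x y ⇔ (R x y ⊎ x ≡ y))
           (u v : Ultrafilter X) where

    -- If the extension holds for `R′` but fails for `R`, only the added equality can account for
    -- it, and this forces a singleton into `v` and then into `u`.
    Extension-reflClosure :
      Extension R′ u v ⇔ (Extension R u v ⊎ EqualPrincipal u v)
    Extension-reflClosure = mk⇔ forth [ back-strict , back-principal ]
      where
      forth : Extension R′ u v → Extension R u v ⊎ EqualPrincipal u v
      forth uR′v with em₀ {Extension R u v}
      ... | yes uRv = inj₁ uRv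
      ... | no ¬uRv = inj₂ (principals (satisfiable u generators∈u))
        where
        -- For `u`-most `x`, the difference of `R′ x` and `R x` is in `v`, and it lies inside the
        -- singleton of `x`.
        generators∈u : (λ x → (_≡ x) ∈ᵤ v) ∈ᵤ u
        generators∈u = upwardClosed u
          (λ { (R′x , ¬Rx) → upwardClosed v
            (λ { (R′xy , ¬Rxy) → [ ⊥-elim ∘ ¬Rxy , sym ] (to closure R′xy) })
            (∩-closed v R′x (∁-member v ¬Rx)) })
          (∩-closed u uR′v (∁-member u ¬uRv))

        principals : Satisfiable (λ x → (_≡ x) ∈ᵤ v) → EqualPrincipal u v
        principals (x , x∈v) = x , singleton-principal u x∈u , v≈x
          where
          v≈x = singleton-principal v x∈v
          -- `v` has only one generator, so the set of its generators, a member of `u`, is contained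
          -- in the singleton of `x`.
          x∈u = upwardClosed u (sym ∘ proj₁ v≈x) generators∈u

      back-strict : Extension R u v → Extension R′ u v
      back-strict =
        upwardClosed u (upwardClosed v (from closure ∘ inj₁))

      back-principal : EqualPrincipal u v → Extension R′ u v
      back-principal (x , u≈x , v≈x) =
        proj₂ u≈x (proj₂ v≈x (from closure (inj₂ refl)))

-- Supports and the extension of the strict order.

module SupportProperties {ℓ : Level} (em : ExcludedMiddle (suc ℓ)) {X : Set ℓ}
                         {_<_ : Rel X ℓ} (isSTO : IsStrictTotalOrder _≡_ _<_) where
  open Classical em
  open Supports em isSTO
  open UltrafilterProperties em {X}
  open IsStrictTotalOrder isSTO using (compare; trans; irrefl)
  open IsLeftHalfCut
  open IsRightHalfCut using (final; noLeast)

  ≮⇒≥ : ∀ {x y} → ¬ x < y → y ≤ x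
  ≮⇒≥ {x} {y} x≮y with compare x y
  ... | tri< x<y _ _ = ⊥-elim (x≮y x<y)
  ... | tri≈ _ x≡y _ = inj₂ (sym x≡y)
  ... | tri> _ _ y<x = inj₁ y<x

  ≤-initial : ∀ m → Initial (_≤ m)
  ≤-initial m x<y (inj₁ y<m)  = inj₁ (trans x<y y<m)
  ≤-initial m x<y (inj₂ refl) = inj₁ x<y

  -- A relation in place of the function `supp`: it hides the choices made by `em` and the resizing,
  -- and it passes to the reversed order unchanged once left and right are exchanged.
  HasSupport : Ultrafilter X → Support → Set (suc ℓ)
  HasSupport u (point x)   = u ≈ᵤ principal x
  HasSupport u (left S _)  = S ∈ᵤ u × (∀ {T} → T ∈ᵤ u → Initial T → S ⊆ T)
  HasSupport u (right S _) = S ∈ᵤ u × (∀ {T} → T ∈ᵤ u → Final T → S ⊆ T)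

  supp-hasSupport : ∀ u → HasSupport u (supp u)
  supp-hasSupport u with em {Principal u} | em₀ {I u ∈ᵤ u}
  ... | yes (_ , u≈x) | _       = u≈x
  ... | no _          | yes I∈u = I∈u , λ T∈u ini x∈I → unresize x∈I (_ , T∈u , ini)
  ... | no _          | no I∉u  = J∈u u I∉u , λ T∈u fin x∈J → unresize x∈J (_ , T∈u , fin)

  -- A generator `x` would lie in `S`, while the initial segment `(_≤ x)` would contain `S`, making
  -- `x` greatest in the cut.
  left⇒nonPrincipal : ∀ u {S} S-cut → HasSupport u (left S S-cut) → NonPrincipal u
  left⇒nonPrincipal u S-cut (S∈u , S-least) (x , u≈x) =
    noGreatest S-cut
      (x , proj₁ u≈x S∈u , S-least (proj₂ u≈x (inj₂ refl)) (≤-initial x))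

  left⇒I≐ : ∀ u {S} S-cut → HasSupport u (left S S-cut) → I u ≐ S
  left⇒I≐ u S-cut (S∈u , S-least) =
    (λ x∈I → unresize x∈I (_ , S∈u , initial S-cut)) ,
    (λ x∈S → resize λ { (_ , T∈u , ini) → S-least T∈u ini x∈S })

  -- `I u` and `S` would meet in some `x`. As `x` lies in both, neither open ray at `x` is in `u`,
  -- so `u` is generated by `x`.
  SuppIsI⇒¬right : ∀ u {S} S-cut → SuppIsI u → ¬ HasSupport u (right S S-cut)
  SuppIsI⇒¬right u _ (np , I∈u) (S∈u , S-least)
    with satisfiable u (∩-closed u I∈u S∈u)
  ... | x , x∈I , x∈S = np (x , singleton-principal u
    (upwardClosed u (λ { (y≮x , x≮y) → only y≮x (≮⇒≥ x≮y) })
      (∩-closed u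
        (∁-member u (λ below → irrefl refl (unresize x∈I (_ , below , trans))))
        (∁-member u (λ above → irrefl refl (S-least above (flip trans) x∈S))))))
    where
    only : ∀ {y} → ¬ y < x → y ≤ x → y ≡ x
    only y≮x = [ ⊥-elim ∘ y≮x , id ]

  -- The counterpart of `SameI` that mentions supports only, so that the comparison of kinds can
  -- forget the ultrafilters.
  SameLeft : Rel Support ℓ
  SameLeft (left S _) (left T _) = S ≐ T
  SameLeft _          _          = Empty.⊥

  SameI⇔SameLeft : ∀ u v s t → HasSupport u s → HasSupport v t →
                   SameI u v ⇔ SameLeft s t
  SameI⇔SameLeft u v s t hu hv = mk⇔ (forth s t hu hv) (back s t hu hv)
    where
    forth : ∀ s t → HasSupport u s → HasSupport v t → SameI u v → SameLeft s t
    forth (point x)   _           hu hv (uI , _)     = ⊥-elim (proj₁ uI (x , hu))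
    forth (right _ c) _           hu hv (uI , _)     = ⊥-elim (SuppIsI⇒¬right u c uI hu)
    forth (left _ _)  (point y)   hu hv (_ , vI , _) = ⊥-elim (proj₁ vI (y , hv))
    forth (left _ _)  (right _ d) hu hv (_ , vI , _) = ⊥-elim (SuppIsI⇒¬right v d vI hv)
    forth (left _ c)  (left _ d)  hu hv (_ , _ , Iu⊆Iv , Iv⊆Iu)
      with left⇒I≐ u c hu | left⇒I≐ v d hv
    ... | Iu⊆S , S⊆Iu | Iv⊆T , T⊆Iv =
      Iv⊆T ∘ Iu⊆Iv ∘ S⊆Iu , Iu⊆S ∘ Iv⊆Iu ∘ T⊆Iv

    back : ∀ s t → HasSupport u s → HasSupport v t → SameLeft s t → SameI u v
    back (left _ c) (left _ d) hu hv (S⊆T , T⊆S)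
      with left⇒I≐ u c hu | left⇒I≐ v d hv
    ... | Iu⊆S , S⊆Iu | Iv⊆T , T⊆Iv =
      (left⇒nonPrincipal u c hu , upwardClosed u S⊆Iu (proj₁ hu)) ,
      (left⇒nonPrincipal v d hv , upwardClosed v T⊆Iv (proj₁ hv)) ,
      T⊆Iv ∘ S⊆T ∘ Iu⊆S , S⊆Iu ∘ T⊆S ∘ Iv⊆T

  Below : Support → Pred X ℓ
  Below s x = point x <ₛ s

  Below-initial : ∀ s → Initial (Below s)
  Below-initial (point _)       = trans
  Below-initial (left _ S-cut)  = initial S-cut
  Below-initial (right _ S-cut) = λ x<y y∉S x∈S → y∉S (final S-cut x<y x∈S)

  ray∈⇔Below : ∀ v t → HasSupport v t → ∀ {x} → (x <_) ∈ᵤ v ⇔ x ∈ Below t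
  ray∈⇔Below v (point y) v≈y = mk⇔ (proj₁ v≈y) (proj₂ v≈y)
  ray∈⇔Below v (left S S-cut) (S∈v , S-least) {x} = mk⇔ forth back
    where
    forth : (x <_) ∈ᵤ v → x ∈ S
    forth ray∈v with satisfiable v (∩-closed v ray∈v S∈v)
    ... | _ , x<y , y∈S = initial S-cut x<y y∈S
    back : x ∈ S → (x <_) ∈ᵤ v
    -- Otherwise the complement of the ray puts `(_≤ x)` in `v`; this initial segment contains `S`,
    -- so `x` is greatest in `S`.
    back x∈S = stable λ ray∉v → noGreatest S-cut
      (x , x∈S , S-least (upwardClosed v ≮⇒≥ (∁-member v ray∉v)) (≤-initial x))
  ray∈⇔Below v (right S S-cut) (S∈v , S-least) {x} = mk⇔ forth back
    where
    -- The ray is a final segment, so as a member of `v` it contains `S`, but it omits `x`.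
    forth : (x <_) ∈ᵤ v → x ∉ S
    forth ray∈v x∈S = irrefl refl (S-least ray∈v (flip trans) x∈S)
    back : x ∉ S → (x <_) ∈ᵤ v
    back x∉S = upwardClosed v (λ y∈S → stable λ x≮y → x∉S (up (≮⇒≥ x≮y) y∈S)) S∈v
      where
      up : ∀ {y} → y ≤ x → y ∈ S → x ∈ S
      up (inj₁ y<x)  = final S-cut y<x
      up (inj₂ refl) = id

  infix 4 _◃_

  _◃_ : Support → Pred X ℓ → Set ℓ
  point x   ◃ T = x ∈ T
  left S _  ◃ T = S ⊆ T
  right S _ ◃ T = T ≬ S

  initial∈⇔◃ : ∀ u s → HasSupport u s → ∀ {T} → Initial T → T ∈ᵤ u ⇔ s ◃ T
  initial∈⇔◃ u (point x) u≈x ini = mk⇔ (proj₁ u≈x) (proj₂ u≈x)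
  initial∈⇔◃ u (left S _) (S∈u , S-least) {T} ini = mk⇔ {B = S ⊆ T}
    (λ T∈u → S-least T∈u ini)
    (λ S⊆T → upwardClosed u S⊆T S∈u)
  initial∈⇔◃ u (right S _) (S∈u , S-least) {T} ini = mk⇔
    (λ T∈u → satisfiable u (∩-closed u T∈u S∈u))
    -- If `T` were not in `u`, its complement would be a final segment in `u`, hence contain `S`,
    -- and `T` could not meet `S`.
    (λ { (_ , x∈T , x∈S) → stable λ T∉u →
      S-least (∁-member u T∉u) (λ y<x y∉T x∈T → y∉T (ini y<x x∈T)) x∈S x∈T })

  -- The asymmetry between the two kinds of cuts arises here. For two left cuts the left side is
  -- plain inclusion, which allows equality; for two right cuts it asks for a point of `S` outside
  -- `T`, which excludes it.
  ◃Below⇔ : ∀ s t → s ◃ Below t ⇔ (s <ₛ t ⊎ SameLeft s t)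
  ◃Below⇔ s t = mk⇔ (forth s t) [ strict s t , same s t ]
    where
    forth : ∀ s t → s ◃ Below t → s <ₛ t ⊎ SameLeft s t
    forth (point _)  _           x∈B = inj₁ x∈B
    forth (left _ _) (point _)   S⊆B = inj₁ λ x∈S → irrefl refl (S⊆B x∈S)
    forth (left S _) (left T _)  S⊆T with em₀ {T ⊆ S}
    ... | yes T⊆S = inj₂ (S⊆T , T⊆S)
    ... | no  T⊈S = inj₁ (S⊆T , T⊈S)
    forth (left _ _) (right _ _) S⊆∁T = inj₁ λ { (x∈S , x∈T) → S⊆∁T x∈S x∈T }
    forth (right _ S-cut) (point _) (_ , y<x , y∈S) = inj₁ (final S-cut y<x y∈S)
    forth (right _ _) (left _ _) T≬S = inj₁ T≬S
    forth (right S S-cut) (right T T-cut) (x , x∉T , x∈S) =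
      inj₁ (T⊆S , λ S⊆T → x∉T (S⊆T x∈S))
      where
      T⊆S : T ⊆ S
      -- A point of `T` below `x` would put `x` into `T`; all others are at or above `x`, hence in
      -- `S`.
      T⊆S {y} y∈T with compare x y
      ... | tri< x<y _ _  = final S-cut x<y x∈S
      ... | tri≈ _ refl _ = x∈S
      ... | tri> _ _ y<x  = ⊥-elim (x∉T (final T-cut y<x y∈T))

    strict : ∀ s t → s <ₛ t → s ◃ Below t
    strict (point _)  _ x∈B = x∈B
    strict (left _ S-cut) (point x) x∉S {y} y∈S with compare y x
    ... | tri< y<x _ _  = y<x
    ... | tri≈ _ refl _ = ⊥-elim (x∉S y∈S)
    ... | tri> _ _ x<y  = ⊥-elim (x∉S (initial S-cut x<y y∈S))
    strict (left _ _)  (left _ _)  (S⊆T , _) = S⊆T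
    strict (left _ _)  (right _ _) S⊥T x∈S x∈T = S⊥T (x∈S , x∈T)
    -- If nothing in `S` were below `x`, then `x` would be least in `S`.
    strict (right S S-cut) (point x) x∈S = stable λ disjoint →
      noLeast S-cut (x , x∈S , λ y∈S → ≮⇒≥ λ y<x → disjoint (_ , y<x , y∈S))
    strict (right _ _) (left _ _) T≬S = T≬S
    strict (right _ _) (right _ _) (_ , S⊈T) = stable λ disjoint →
      S⊈T λ x∈S → stable λ x∉T → disjoint (_ , x∉T , x∈S)

    same : ∀ s t → SameLeft s t → s ◃ Below t
    same (left _ _) (left _ _) = proj₁

  -- Stating this for any `s` and `t` that satisfy `HasSupport` allows its use in the reversed order
  -- with dual supports.
  <~⇔ : ∀ u v s t → HasSupport u s → HasSupport v t →
        u <~ v ⇔ (s <ₛ t ⊎ SameI u v)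
  <~⇔ u v s t hu hv = mk⇔
    (map₂ (from same) ∘ to (◃Below⇔ s t) ∘ to mem ∘ upwardClosed u (to ray))
    (upwardClosed u (from ray) ∘ from mem ∘ from (◃Below⇔ s t) ∘ map₂ (to same))
    where
    same = SameI⇔SameLeft u v s t hu hv
    mem  = initial∈⇔◃ u s hu (Below-initial t)
    ray : ∀ {x} → (x <_) ∈ᵤ v ⇔ x ∈ Below t
    ray = ray∈⇔Below v t hv

-- Reversal of the order.

module Duality {ℓ : Level} (em : ExcludedMiddle (suc ℓ)) {X : Set ℓ}
               {_<_ : Rel X ℓ} (isSTO : IsStrictTotalOrder _≡_ _<_) where
  open Supports em isSTO
  open SupportProperties em isSTO

  private
    isSTOᵒ = Flip.isStrictTotalOrder isSTO
    module Op = Supports em isSTOᵒ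
    module OpProperties = SupportProperties em isSTOᵒ

  -- Reversal exchanges initial and final segments by definition, so the set stays and only its side
  -- changes; in the extremality conditions just the equality case has to be turned around.
  dual : Support → Op.Support
  dual (point x)   = Op.point x
  dual (left S c)  = Op.right S record
    { nonempty = nonempty
    ; final    = initial
    ; noLeast  = λ { (m , m∈S , min) → noGreatest (m , m∈S , map₂ sym ∘ min) }
    }
    where open IsLeftHalfCut c
  dual (right S c) = Op.left S record
    { nonempty   = nonempty
    ; initial    = final
    ; noGreatest = λ { (m , m∈S , max) → noLeast (m , m∈S , map₂ sym ∘ max) }
    }
    where open IsRightHalfCut c

  dual-hasSupport : ∀ u s → HasSupport u s → OpProperties.HasSupport u (dual s)
  dual-hasSupport u (point _)   h = h
  dual-hasSupport u (left _ _)  h = h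
  dual-hasSupport u (right _ _) h = h

  dual-<⇔> : ∀ s t → dual s Op.<ₛ dual t ⇔ s >ₛ t
  dual-<⇔> (point _)   (point _)   = mk⇔ id id
  dual-<⇔> (point _)   (left _ _)  = mk⇔ id id
  dual-<⇔> (point _)   (right _ _) = mk⇔ id id
  dual-<⇔> (left _ _)  (point _)   = mk⇔ id id
  dual-<⇔> (left _ _)  (left _ _)  = mk⇔ id id
  dual-<⇔> (left _ _)  (right _ _) = mk⇔ ≬-sym ≬-sym
  dual-<⇔> (right _ _) (point _)   = mk⇔ id id
  dual-<⇔> (right _ _) (left _ _)  = mk⇔ ⊥-sym ⊥-sym
  dual-<⇔> (right _ _) (right _ _) = mk⇔ id id

  -- In the reversed order `I` unfolds to `J`, `SameI` to `SameJ` and `<~` to `>~`, so only the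
  -- order on supports needs translation.
  >~⇔ : ∀ u v s t → HasSupport u s → HasSupport v t →
        u >~ v ⇔ (s >ₛ t ⊎ SameJ u v)
  >~⇔ u v s t hu hv =
    mk⇔ (map₁ (to (dual-<⇔> s t)) ∘ to e) (from e ∘ map₁ (from (dual-<⇔> s t)))
    where
    e = OpProperties.<~⇔ u v (dual s) (dual t)
          (dual-hasSupport u s hu) (dual-hasSupport v t hv)

theorem1 : ∀ {ℓ : Level} (em : ExcludedMiddle (suc ℓ)) (X : Set ℓ) (_<_ : Rel X ℓ)
    (isSTO : IsStrictTotalOrder _≡_ _<_) →
    let open Supports em isSTO in
    (∀ (u v : Ultrafilter X) →
    (u <~ v ⇔ (supp u <ₛ supp v ⊎ SameI u v)) ×
    (u ≤~ v ⇔ (supp u <ₛ supp v ⊎ SameI u v ⊎ SamePoint u v)) ×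
    (u >~ v ⇔ (supp u >ₛ supp v ⊎ SameJ u v)) ×
    (u ≥~ v ⇔ (supp u >ₛ supp v ⊎ SameJ u v ⊎ SamePoint u v))) ×
    (∀ (u v : Ultrafilter X) → NonPrincipal u → NonPrincipal v →
    (u <~ v ⇔ u ≤~ v) × (u >~ v ⇔ u ≥~ v))
theorem1 em X _<_ isSTO =
  (λ u v → < u v , widen (≤ u v) (< u v) , > u v , widen (≥ u v) (> u v)) ,
  (λ u v u-np _ → onNonPrincipal u v u-np (≤ u v) , onNonPrincipal u v u-np (≥ u v))
  where
  open Supports em isSTO
  open SupportProperties em isSTO using (supp-hasSupport; <~⇔)
  open UltrafilterProperties em {X} using (Extension-reflClosure)

  < : ∀ u v → u <~ v ⇔ (supp u <ₛ supp v ⊎ SameI u v)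
  < u v = <~⇔ u v _ _ (supp-hasSupport u) (supp-hasSupport v)

  > : ∀ u v → u >~ v ⇔ (supp u >ₛ supp v ⊎ SameJ u v)
  > u v = Duality.>~⇔ em isSTO u v _ _ (supp-hasSupport u) (supp-hasSupport v)

  ≤ : ∀ u v → u ≤~ v ⇔ (u <~ v ⊎ SamePoint u v)
  ≤ = Extension-reflClosure (mk⇔ id id)

  ≥ : ∀ u v → u ≥~ v ⇔ (u >~ v ⊎ SamePoint u v)
  -- The equality inside `flip _≤_` runs from the second argument to the first, hence `sym`.
  ≥ = Extension-reflClosure (mk⇔ (map₂ sym) (map₂ sym))

  widen : ∀ {a b c d e} {A : Set a} {B : Set b} {C : Set c} {D : Set d} {E : Set e} →
          A ⇔ (B ⊎ C) → B ⇔ (D ⊎ E) → A ⇔ (D ⊎ E ⊎ C)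
  widen f g = mk⇔ (assocʳ ∘ map₁ (to g) ∘ to f) (from f ∘ map₁ (from g) ∘ assocˡ)

  onNonPrincipal : ∀ {a b} {A : Set a} {B : Set b} u v → NonPrincipal u →
                   A ⇔ (B ⊎ SamePoint u v) → B ⇔ A
  onNonPrincipal _ _ u-np f = mk⇔ (from f ∘ inj₁)
    ([ id , (λ { (x , u≈x , _) → ⊥-elim (u-np (x , u≈x)) }) ] ∘ to f)
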